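{- Let $\mathcal{C}^u_f$ be the class of $\mathsf{TUS}$-frames and $\mathcal{C}^d_f$ the class of $\mathsf{TDS}$-frames. For every $\phi\in\mathcal{L}_{\mathsf{TDS}}$: $\mathcal{C}^d_f\models\phi$ implies $\mathcal{C}^u_f\models\phi$.
   Context: **Language.** Let $Ag=\{1,2,\dots,n\}$ be a finite set of agent labels and $Var=\{p_1,p_2,p_3,\dots\}$ a countable set of propositional variables. $\mathcal{L}_{\mathsf{TDS}}$ is given by $\phi ::= p \mid \neg\phi \mid \phi\land\phi \mid \Box\phi \mid [i]\phi \mid [Ag]\phi \mid \mathsf{G}\phi \mid \mathsf{H}\phi \mid \otimes_i\phi$ with $i\in Ag$, $p\in Var$. **Common conditions.** For binary relations on a non-empty set $W$, write $R(w)=\{v\in W:(w,v)\in R\}$. Consider: - $R_\Box$, all $R_{[i]}$ ($i\in Ag$), and $R_{[Ag]}$ are equivalence relations, and for all $i\in Ag$: (C1) $R_{[i]}\subseteq R_\Box$; (C2) for all $u_1,\dots,u_n\in W$, if $R_\Box u_iu_j$ for all $1\le i,j\le n$, then $\bigcap_{i}R_{[i]}(u_i)\neq\emptyset$; (C3) for all $w$, $R_{[Ag]}(w)\subseteq\bigcap_{i\in Ag}R_{[i]}(w)$. - $R_{\mathsf G}$ is transitive and serial, $R_{\mathsf H}$ is the converse of $R_{\mathsf G}$, and: (T4) if $R_{\mathsf G}wu$ and $R_{\mathsf G}wv$ then $R_{\mathsf G}uv$, $u=v$, or $R_{\mathsf G}vu$; (T5) if $R_{\mathsf H}wu$ and $R_{\mathsf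 H}wv$ then $R_{\mathsf H}uv$, $u=v$, or $R_{\mathsf H}vu$; (T6) $R_{\mathsf G}\circ R_\Box\subseteq R_{[Ag]}\circ R_{\mathsf G}$, i.e. if $R_{\mathsf G}wu$ and $R_\Box uv$ then there is $x$ with $R_{[Ag]}wx$ and $R_{\mathsf G}xv$; (T7) if $u\in R_\Box(w)$ then $u\notin R_{\mathsf G}(w)$. **$\mathsf{TDS}$-frames.** A $\mathsf{TDS}$-frame is $(W,R_\Box,\{R_{[i]}\}_{i\in Ag},R_{[Ag]},R_{\mathsf G},R_{\mathsf H},\{R_{\otimes_i}\}_{i\in Ag})$ satisfying the common conditions and, for all $i\in Ag$: (D8) $R_{\otimes_i}\subseteq R_\Box$; (D9) for all $w$ there is $v$ with $R_\Box wv$ such that for all $u$, $R_{[i]}vu$ implies $R_{\otimes_i}wu$; (D10) for all $w,v,u,z$, if $R_\Box wv$, $R_\Box wu$ and $R_{\otimes_i}uz$, then $R_{\otimes_i}vz$; (D11) for all $w,v$, if $R_{\otimes_i}wv$ then there is $u$ with $R_\Box wu$, $R_{[i]}uv$, and for all $z$, $R_{[i]}uz$ implies $R_{\otimes_i}wz$. **$\mathsf{TUS}$-frames.** A $\mathsf{TUS}$-frame is $(W,R_\Box,\{R_{[i]}\}_{i\in Ag},R_{[Ag]},R_{\mathsf G},R_{\mathsf H},util)$ satisfying the common conditions, with $util:W\to\mathbb{N}$ any function. **Models and satisfaction.** A model is a frame with a valuation $V:Var\to\mathcal{P}(W)$. In both kinds of models, $M,w\models p$ iff $w\in V(p)$,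 Boolean clauses are as usual, and $\Box,[i],[Ag],\mathsf G,\mathsf H$ are the universal modalities of $R_\Box,R_{[i]},R_{[Ag]},R_{\mathsf G},R_{\mathsf H}$. In $\mathsf{TDS}$-models, $M,w\models\otimes_i\phi$ iff $M,u\models\phi$ for all $u\in R_{\otimes_i}(w)$. In $\mathsf{TUS}$-models the clause for $\otimes_i$ uses the following. - State for $i$ at $v$: $R^s_{[i]}(v)=\bigcap_{k\in Ag\setminus\{i\}}R_{[k]}(v)$ (if $Ag=\{i\}$, this is read as $R_\Box(v)$). - For $X,Y\subseteq R_\Box(w)$: $X\le Y$ iff $util(x)\le util(y)$ for all $x\in X,y\in Y$. - For $R_{[i]}(v),R_{[i]}(z)\subseteq R_\Box(w)$: $R_{[i]}(v)\preceq R_{[i]}(z)$ iff for all $R^s_{[i]}(x)\subseteq R_\Box(w)$, $R_{[i]}(v)\cap R^s_{[i]}(x)\le R_{[i]}(z)\cap R^s_{[i]}(x)$; and $R_{[i]}(v)\prec R_{[i]}(z)$ iff $R_{[i]}(v)\preceq R_{[i]}(z)$ and $R_{[i]}(z)\not\preceq R_{[i]}(v)$. With $\|\phi\|=\{w: M,w\models\phi\}$: $M,w\models\otimes_i\phi$ iff for every $R_{[i]}(v)\subseteq R_\Box(w)$ with $R_{[i]}(v)\not\subseteq\|\phi\|$ there is $R_{[i]}(z)\subseteq R_\Box(w)$ such that (i) $R_{[i]}(v)\prec R_{[i]}(z)$, (ii) $R_{[i]}(z)\subseteq\|\phi\|$, and (iii) for all $R_{[i]}(x)\subseteq R_\Box(w)$,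 $R_{[i]}(z)\preceq R_{[i]}(x)$ implies $R_{[i]}(x)\subseteq\|\phi\|$. **Validity.** For a class $\mathcal C$ of frames, $\mathcal C\models\phi$ means $M,w\models\phi$ for every model $M$ based on a frame in $\mathcal C$ and every world $w$ of $M$. -}

module Defs where

open import Level using (Level; suc)
open import Data.Fin.Base using (Fin)
open import Data.Nat.Base using (ℕ; _≤_)
open import Data.Product.Base using (_×_; ∃)
open import Data.Sum.Base using (_⊎_)
open import Function.Base using (flip)
open import Relation.Binary.Core using (Rel; _⇒_; _⇔_)
open import Relation.Binary.Definitions using (Transitive)
open import Relation.Binary.PropositionalEquality.Core using (_≡_; _≢_)
open import Relation.Binary.Structures using (IsEquivalence)
open import Relation.Nullary.Negation.Core using (¬_)
open import Relation.Unary using (Pred; _∈_; _∉_; _⊆_; _⊈_; _∩_; ⋂; Satisfiable)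

Var : Set
Var = ℕ

infix  10 ~_ □_ [_]_ [Ag]_ 𝖦_ 𝖧_ ⊗[_]_
infixr 9  _∧_

-- The set of agents is Fin n.
data Formula (n : ℕ) : Set where
  var   : Var → Formula n
  ~_    : Formula n → Formula n
  _∧_   : Formula n → Formula n → Formula n
  □_    : Formula n → Formula n
  [_]_  : Fin n → Formula n → Formula n
  [Ag]_ : Formula n → Formula n
  𝖦_    : Formula n → Formula n
  𝖧_    : Formula n → Formula n
  ⊗[_]_ : Fin n → Formula n → Formula n

-- A relation R : Rel W ℓ doubles as the map w ↦ R(w): the partial application
-- R w is the predicate of R-successors of w.
record CommonFrame (n : ℕ) (ℓ : Level) : Set (suc ℓ) where
  field
    W     : Set ℓ
    point : W
    R□    : Rel W ℓ
    R[_]  : Fin n → Rel W ℓ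
    R[Ag] : Rel W ℓ
    RG    : Rel W ℓ
    RH    : Rel W ℓ

    R□-equiv    : IsEquivalence R□
    R[]-equiv   : ∀ i → IsEquivalence R[ i ]
    R[Ag]-equiv : IsEquivalence R[Ag]

    C1 : ∀ i → R[ i ] ⇒ R□
    C2 : (u : Fin n → W) → (∀ i j → R□ (u i) (u j)) →
         Satisfiable (⋂ (Fin n) (λ i → R[ i ] (u i)))
    C3 : ∀ w → R[Ag] w ⊆ ⋂ (Fin n) (λ i → R[ i ] w)

    RG-trans    : Transitive RG
    RG-serial   : ∀ w → Satisfiable (RG w)
    RH-converse : RH ⇔ flip RG

    T4 : ∀ {w u v} → RG w u → RG w v → RG u v ⊎ u ≡ v ⊎ RG v u
    T5 : ∀ {w u v} → RH w u → RH w v → RH u v ⊎ u ≡ v ⊎ RH v u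
    T6 : ∀ {w u v} → RG w u → R□ u v → ∃ λ x → R[Ag] w x × RG x v
    T7 : ∀ {w u} → u ∈ R□ w → u ∉ RG w

record TDSFrame (n : ℕ) (ℓ : Level) : Set (suc ℓ) where
  field
    common : CommonFrame n ℓ
  open CommonFrame common public
  field
    R⊗  : Fin n → Rel W ℓ
    D8  : ∀ i → R⊗ i ⇒ R□
    D9  : ∀ i w → ∃ λ v → R□ w v × (∀ u → R[ i ] v u → R⊗ i w u)
    D10 : ∀ i {w v u z} → R□ w v → R□ w u → R⊗ i u z → R⊗ i v z
    D11 : ∀ i {w v} → R⊗ i w v →
          ∃ λ u → R□ w u × R[ i ] u v × (∀ z → R[ i ] u z → R⊗ i w z)

record TUSFrame (n : ℕ) (ℓ : Level) : Set (suc ℓ) where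
  field
    common : CommonFrame n ℓ
  open CommonFrame common public
  field
    util : W → ℕ

-- The clauses common to both kinds of models; `ought i ‖φ‖` is the truth set
-- of ⊗[ i ] φ.
module Satisfaction {n ℓ} (F : CommonFrame n ℓ)
                    (ought : Fin n → Pred (CommonFrame.W F) ℓ →
                             Pred (CommonFrame.W F) ℓ) where
  open CommonFrame F

  module _ (V : Var → Pred W ℓ) where

    infix 4 _⊨_

    _⊨_ : W → Formula n → Set ℓ
    w ⊨ var p    = w ∈ V p
    w ⊨ ~ φ      = ¬ (w ⊨ φ)
    w ⊨ φ ∧ ψ    = w ⊨ φ × w ⊨ ψ
    w ⊨ □ φ      = ∀ u → R□ w u → u ⊨ φ
    w ⊨ [ i ] φ  = ∀ u → R[ i ] w u → u ⊨ φ
    w ⊨ [Ag] φ   = ∀ u → R[Ag] w u → u ⊨ φ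
    w ⊨ 𝖦 φ      = ∀ u → RG w u → u ⊨ φ
    w ⊨ 𝖧 φ      = ∀ u → RH w u → u ⊨ φ
    w ⊨ ⊗[ i ] φ = ought i (λ u → u ⊨ φ) w

  Valid : Formula n → Set (suc ℓ)
  Valid φ = ∀ V w → _⊨_ V w φ

module TDSSemantics {n ℓ} (F : TDSFrame n ℓ) where
  open TDSFrame F

  ought : Fin n → Pred W ℓ → Pred W ℓ
  ought i ‖φ‖ w = ∀ u → R⊗ i w u → u ∈ ‖φ‖

  open Satisfaction common ought public

module TUSSemantics {n ℓ} (F : TUSFrame n ℓ) where
  open TUSFrame F

  -- The first conjunct only has force when Ag = {i}, where the intersection
  -- over the remaining agents is empty and is read as R□ v.
  Rˢ[_] : Fin n → Rel W ℓ
  Rˢ[ i ] v u = ((∀ k → k ≡ i) → R□ v u) × (∀ k → k ≢ i → R[ k ] v u)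

  infix 4 _≤ᵘ_

  _≤ᵘ_ : Pred W ℓ → Pred W ℓ → Set ℓ
  X ≤ᵘ Y = ∀ {x y} → x ∈ X → y ∈ Y → util x ≤ util y

  -- The comparison of choices of agent i at the moment R□ w.
  module Preference (i : Fin n) (w : W) where

    infix 4 _⪯_ _≺_

    _⪯_ : Pred W ℓ → Pred W ℓ → Set ℓ
    X ⪯ Y = ∀ x → Rˢ[ i ] x ⊆ R□ w → X ∩ Rˢ[ i ] x ≤ᵘ Y ∩ Rˢ[ i ] x

    _≺_ : Pred W ℓ → Pred W ℓ → Set ℓ
    X ≺ Y = X ⪯ Y × ¬ (Y ⪯ X)

  ought : Fin n → Pred W ℓ → Pred W ℓ
  ought i ‖φ‖ w =
    ∀ v → R[ i ] v ⊆ R□ w → R[ i ] v ⊈ ‖φ‖ →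
    ∃ λ z → R[ i ] z ⊆ R□ w
          × R[ i ] v ≺ R[ i ] z
          × R[ i ] z ⊆ ‖φ‖
          × (∀ x → R[ i ] x ⊆ R□ w → R[ i ] z ⪯ R[ i ] x → R[ i ] x ⊆ ‖φ‖)
    where open Preference i w

  open Satisfaction common ought public

infix 4 𝒞ᵈ[_]⊨_ 𝒞ᵘ[_]⊨_

𝒞ᵈ[_]⊨_ : ∀ {n} (ℓ : Level) → Formula n → Set (suc ℓ)
𝒞ᵈ[_]⊨_ {n} ℓ φ = (F : TDSFrame n ℓ) → TDSSemantics.Valid F φ

𝒞ᵘ[_]⊨_ : ∀ {n} (ℓ : Level) → Formula n → Set (suc ℓ)
𝒞ᵘ[_]⊨_ {n} ℓ φ = (F : TUSFrame n ℓ) → TUSSemantics.Valid F φ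

{-# OPTIONS --safe #-}
-- Over a TUS-model, ⊗ᵢ is a normal operator, although it is in general not the
-- universal modality of a relation: with infinitely many choices there need not
-- be any optimal ones. But for a single formula φ only the finitely many ψ for
-- which ⊗ᵢψ is a subformula of φ matter. On the same frame, declare optimal at w
-- those choices of i that force every such ψ with w ⊨ ⊗ᵢψ. As ⊗ᵢ is closed
-- under finite conjunctions, this set of choices is itself obligatory at w; so
-- it is non-empty, and by monotonicity every ψ that it forces is obligatory. The
-- resulting TDS-model agrees with the TUS-model on all subformulas of φ.
module Submission where

open import Defs
open import Axiom.DoubleNegationElimination using (em⇒dne)
open import Axiom.ExcludedMiddle using (ExcludedMiddle)
open import Data.Empty using (⊥-elim)
open import Data.Fin.Base using (Fin)
open import Data.Fin.Properties using (_≟_)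
open import Data.List.Base using (List; []; _∷_; _++_)
open import Data.List.Relation.Binary.Subset.Propositional
  using () renaming (_⊆_ to _⊆ˡ_)
open import Data.List.Relation.Binary.Subset.Propositional.Properties
  using (xs⊆xs++ys; xs⊆ys++xs; ⊆-refl)
open import Data.List.Relation.Unary.All as All using (All; []; _∷_)
open import Data.List.Relation.Unary.Any using (here; there)
open import Data.Nat.Properties using (≤-trans)
open import Data.Product.Base using (_×_; _,_; proj₁; proj₂; ∃; map)
open import Data.Sum.Base using (_⊎_; inj₁; inj₂)
open import Function.Base using (_∘_; id)
open import Function.Bundles using (_⇔_; mk⇔; Equivalence)
open import Relation.Binary.Core using (Rel)
open import Relation.Binary.PropositionalEquality.Core using (_≡_; refl)
open import Relation.Binary.Structures using (IsEquivalence)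
open import Relation.Nullary.Decidable.Core using (yes; no)
open import Relation.Nullary.Negation.Core using (¬_)
open import Relation.Unary using (Pred; _∈_; _⊆_; _⊈_; _∩_)

-- Forgetting the agent is harmless: below, a body counts for an agent only where that agent's own
-- obligation to it holds.
⊗-bodies : ∀ {n} → Formula n → List (Formula n)
⊗-bodies (var p)    = []
⊗-bodies (~ φ)      = ⊗-bodies φ
⊗-bodies (φ ∧ ψ)    = ⊗-bodies φ ++ ⊗-bodies ψ
⊗-bodies (□ φ)      = ⊗-bodies φ
⊗-bodies ([ i ] φ)  = ⊗-bodies φ
⊗-bodies ([Ag] φ)   = ⊗-bodies φ
⊗-bodies (𝖦 φ)      = ⊗-bodies φ
⊗-bodies (𝖧 φ)      = ⊗-bodies φ
⊗-bodies (⊗[ i ] φ) = φ ∷ ⊗-bodies φ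

□-cong : ∀ {a} {A : Set a} {P Q : Pred A a} (R : Rel A a) →
         (∀ u → P u ⇔ Q u) → ∀ w → (∀ u → R w u → P u) ⇔ (∀ u → R w u → Q u)
□-cong R P⇔Q w = mk⇔ (λ p u r → Equivalence.to (P⇔Q u) (p u r))
                     (λ q u r → Equivalence.from (P⇔Q u) (q u r))

module Ought {ℓ} (em : ExcludedMiddle ℓ) {n} (F : TUSFrame n ℓ) where
  open TUSFrame F
  open TUSSemantics F using (Rˢ[_]; ought; module Preference)

  private
    module Eq□ = IsEquivalence R□-equiv
    module Eq (i : Fin n) = IsEquivalence (R[]-equiv i)

  choice⊆moment : ∀ i {w v} → R□ w v → R[ i ] v ⊆ R□ w
  choice⊆moment i wv vu = Eq□.trans wv (C1 i vu)

  Rˢ-refl : ∀ i x → Rˢ[ i ] x x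
  Rˢ-refl i x = (λ _ → Eq□.refl) , (λ k _ → Eq.refl k)

  -- Independence of agents (C2), applied to the profile where `i` acts as at `y` and all others as
  -- at `x`.
  choice∩state : ∀ i {w y x} → R□ w y → R□ w x →
                 ∃ λ t → t ∈ R[ i ] y × t ∈ Rˢ[ i ] x
  choice∩state i {w} {y} {x} wy wx = t , iyt , xt□ , xt
    where
    u : Fin n → W
    u k with k ≟ i
    ... | yes _ = y
    ... | no  _ = x

    wu : ∀ k → R□ w (u k)
    wu k with k ≟ i
    ... | yes _ = wy
    ... | no  _ = wx

    common-point = C2 u (λ j k → Eq□.trans (Eq□.sym (wu j)) (wu k))
    t = proj₁ common-point

    iyt : R[ i ] y t
    iyt with i ≟ i | proj₂ common-point i
    ... | yes _   | r = r
    ... | no  i≢i | _ = ⊥-elim (i≢i refl)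

    xt : ∀ k → ¬ (k ≡ i) → R[ k ] x t
    xt k k≢i with k ≟ i | proj₂ common-point k
    ... | yes k≡i | _ = ⊥-elim (k≢i k≡i)
    ... | no  _   | r = r

    xt□ : (∀ k → k ≡ i) → R□ x t
    xt□ _ = Eq□.trans (Eq□.sym wx) (Eq□.trans wy (C1 i iyt))

  module _ (i : Fin n) where

    module _ {w : W} where
      open Preference i w

      -- The middle choice meets every state of the moment, which supplies a point through which the
      -- two utility comparisons are chained.
      ⪯-trans : ∀ {v y z} → R[ i ] y ⊆ R□ w →
                R[ i ] v ⪯ R[ i ] y → R[ i ] y ⪯ R[ i ] z → R[ i ] v ⪯ R[ i ] z
      ⪯-trans y⊆w v⪯y y⪯z x x⊆w vx zx
        with choice∩state i (y⊆w (Eq.refl i)) (x⊆w (Rˢ-refl i x))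
      ... | _ , yt , xt = ≤-trans (v⪯y x x⊆w vx (yt , xt))
                                  (y⪯z x x⊆w (yt , xt) zx)

      -- _⪯_ need not be reflexive: utility may vary on the intersection of a
      -- choice and a state.
      _⪯⁼_ : W → W → Set ℓ
      y ⪯⁼ z = y ≡ z ⊎ R[ i ] y ⪯ R[ i ] z

      ⪯⁼-⪯-trans : ∀ {y z x} → R[ i ] z ⊆ R□ w →
                   y ⪯⁼ z → R[ i ] z ⪯ R[ i ] x → R[ i ] y ⪯ R[ i ] x
      ⪯⁼-⪯-trans _   (inj₁ refl) z⪯x = z⪯x
      ⪯⁼-⪯-trans z⊆w (inj₂ y⪯z)  z⪯x = ⪯-trans z⊆w y⪯z z⪯x

      ≺-⪯⁼-trans : ∀ {v y z} → R[ i ] y ⊆ R□ w → R[ i ] z ⊆ R□ w →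
                   R[ i ] v ≺ R[ i ] y → y ⪯⁼ z → R[ i ] v ≺ R[ i ] z
      ≺-⪯⁼-trans _   _   v≺y         (inj₁ refl) = v≺y
      ≺-⪯⁼-trans y⊆w z⊆w (v⪯y , y⋠v) (inj₂ y⪯z)  =
        ⪯-trans y⊆w v⪯y y⪯z , λ z⪯v → y⋠v (⪯-trans z⊆w y⪯z z⪯v)

      -- Clauses (ii) and (iii) of the truth condition of `⊗`. As `_⪯_` may fail to be reflexive,
      -- (iii) need not cover `z` itself.
      ForcedAbove : W → Pred W ℓ → Set ℓ
      ForcedAbove z X =
        R[ i ] z ⊆ X × (∀ x → R[ i ] x ⊆ R□ w → R[ i ] z ⪯ R[ i ] x → R[ i ] x ⊆ X)

      forcedAbove-⪯⁼ : ∀ {y z X} → R[ i ] z ⊆ R□ w → y ⪯⁼ z →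
                       ForcedAbove y X → ForcedAbove z X
      forcedAbove-⪯⁼ _   (inj₁ refl) y↑        = y↑
      forcedAbove-⪯⁼ z⊆w (inj₂ y⪯z)  (_ , y↑) =
        y↑ _ z⊆w y⪯z , λ x x⊆w z⪯x → y↑ x x⊆w (⪯-trans z⊆w y⪯z z⪯x)

      forcedAbove-∩ : ∀ {z X Y} → ForcedAbove z X → ForcedAbove z Y →
                      ForcedAbove z (X ∩ Y)
      forcedAbove-∩ (z⊆X , X↑) (z⊆Y , Y↑) =
        (λ r → z⊆X r , z⊆Y r) ,
        λ x x⊆w z⪯x r → X↑ x x⊆w z⪯x r , Y↑ x x⊆w z⪯x r

      -- The obligation speaks only of choices that violate `X`. If one weakly above `z` does, the
      -- obligation is applied to it; otherwise `z` itself will do.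
      ought-improve : ∀ {X z} → ought i X w → R[ i ] z ⊆ R□ w →
                      ∃ λ y → R[ i ] y ⊆ R□ w × z ⪯⁼ y × ForcedAbove y X
      ought-improve {X} {z} ◯X z⊆w
        with em {∃ λ y → R[ i ] y ⊆ R□ w × z ⪯⁼ y × R[ i ] y ⊈ X}
      ... | yes (y , y⊆w , z⪯⁼y , y⊈X) =
        let x , x⊆w , y≺x , x↑ = ◯X y y⊆w y⊈X
        in  x , x⊆w , inj₂ (⪯⁼-⪯-trans y⊆w z⪯⁼y (proj₁ y≺x)) , x↑
      ... | no ∄y = z , z⊆w , inj₁ refl , forced z⊆w (inj₁ refl)
                  , λ x x⊆w z⪯x → forced x⊆w (inj₂ z⪯x)
        where
        forced : ∀ {y} → R[ i ] y ⊆ R□ w → z ⪯⁼ y → R[ i ] y ⊆ X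
        forced y⊆w z⪯⁼y =
          em⇒dne em λ y⊈X → ∄y (_ , y⊆w , z⪯⁼y , y⊈X)

      -- The hypothesis compares whole choices, not points, because being ideal will be a property
      -- of the choice through a world.
      ought-mono : ∀ {X Y} → (∀ {v} → R□ w v → R[ i ] v ⊆ X → R[ i ] v ⊆ Y) →
                   ought i X w → ought i Y w
      ought-mono X⊆Y ◯X v v⊆w v⊈Y =
        let z , z⊆w , v≺z , z⊆X , X↑ =
              ◯X v v⊆w (λ v⊆X → v⊈Y (X⊆Y (v⊆w (Eq.refl i)) v⊆X))
        in  z , z⊆w , v≺z , X⊆Y (z⊆w (Eq.refl i)) z⊆X
          , λ x x⊆w z⪯x → X⊆Y (x⊆w (Eq.refl i)) (X↑ x x⊆w z⪯x)

      -- A violated conjunct yields a strict improvement. Improving further for the other conjunct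
      -- loses nothing, since strictness and what is already forced persist upwards.
      ought-∩ : ∀ {X Y} → ought i X w → ought i Y w → ought i (X ∩ Y) w
      ought-∩ {X} {Y} ◯X ◯Y v v⊆w v⊈X∩Y with em {R[ i ] v ⊆ X}
      ... | no v⊈X =
        let z , z⊆w , v≺z , z↑ = ◯X v v⊆w v⊈X
            y , y⊆w , z⪯⁼y , y↑ = ought-improve ◯Y z⊆w
        in  y , y⊆w , ≺-⪯⁼-trans z⊆w y⊆w v≺z z⪯⁼y
          , forcedAbove-∩ (forcedAbove-⪯⁼ y⊆w z⪯⁼y z↑) y↑
      ... | yes v⊆X =
        let z , z⊆w , v≺z , z↑ =
              ◯Y v v⊆w (λ v⊆Y → v⊈X∩Y (λ r → v⊆X r , v⊆Y r))
            y , y⊆w , z⪯⁼y , y↑ = ought-improve ◯X z⊆w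
        in  y , y⊆w , ≺-⪯⁼-trans z⊆w y⊆w v≺z z⪯⁼y
          , forcedAbove-∩ y↑ (forcedAbove-⪯⁼ y⊆w z⪯⁼y z↑)

      ought-satisfiable : ∀ {X} → ought i X w → ∃ λ v → R□ w v × R[ i ] v ⊆ X
      ought-satisfiable ◯X =
        let v , v⊆w , _ , v⊆X , _ = ought-improve ◯X (choice⊆moment i Eq□.refl)
        in  v , v⊆w (Eq.refl i) , v⊆X

    -- The truth condition refers to the world only through its moment, which `w` and `w′` share.
    ought-□ : ∀ {w w′ X} → R□ w w′ → ought i X w → ought i X w′
    ought-□ {w} {w′} ww′ ◯X v v⊆w′ v⊈X =
      let z , z⊆w , (v⪯z , z⋠v) , z⊆X , X↑ = ◯X v (to-w v⊆w′) v⊈X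
      in  z , to-w′ z⊆w
        , ((λ x x⊆w′ → v⪯z x (to-w x⊆w′))
        ,  λ z⪯v → z⋠v (λ x x⊆w → z⪯v x (to-w′ x⊆w)))
        , z⊆X
        , λ x x⊆w′ z⪯x →
            X↑ x (to-w x⊆w′) (λ y y⊆w → z⪯x y (to-w′ y⊆w))
      where
      to-w : ∀ {P : Pred W ℓ} → P ⊆ R□ w′ → P ⊆ R□ w
      to-w P⊆w′ p = Eq□.trans ww′ (P⊆w′ p)

      to-w′ : ∀ {P : Pred W ℓ} → P ⊆ R□ w → P ⊆ R□ w′
      to-w′ P⊆w p = Eq□.trans (Eq□.sym ww′) (P⊆w p)

  module Deontic (V : Var → Pred W ℓ) (L : List (Formula n)) where

    open TUSSemantics F using () renaming (_⊨_ to Sat)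

    infix 4 _⊨ᵘ_
    _⊨ᵘ_ : W → Formula n → Set ℓ
    _⊨ᵘ_ = Sat V

    -- Quantifying over the choice through `u` makes this set a union of choices, as D11 demands.
    -- The list is a parameter for the sake of induction.
    IdealFor : List (Formula n) → Fin n → W → Pred W ℓ
    IdealFor Γ i w u =
      All (λ ψ → w ⊨ᵘ ⊗[ i ] ψ → ∀ z → R[ i ] u z → z ⊨ᵘ ψ) Γ

    idealFor-choice : ∀ {Γ i w u z} → R[ i ] u z →
                      IdealFor Γ i w u → IdealFor Γ i w z
    idealFor-choice {i = i} uz = All.map λ f ⊗ψ x zx → f ⊗ψ x (Eq.trans i uz zx)

    idealFor-□ : ∀ {Γ i w v u} → R□ w v → IdealFor Γ i w u → IdealFor Γ i v u
    idealFor-□ {i = i} wv = All.map λ f ⊗ψ → f (ought-□ i (Eq□.sym wv) ⊗ψ)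

    -- Bodies are conjoined one at a time; one that is not obligatory at `w` constrains nothing.
    ought-idealFor : ∀ Γ i w → ought i (IdealFor Γ i w) w
    ought-idealFor []      i w v _ v⊈ = ⊥-elim (v⊈ λ _ → [])
    ought-idealFor (ψ ∷ Γ) i w with em {w ⊨ᵘ ⊗[ i ] ψ}
    ... | no ¬⊗ψ =
      ought-mono i (λ _ v⊆Γ r → (λ ⊗ψ → ⊥-elim (¬⊗ψ ⊗ψ)) ∷ v⊆Γ r)
        (ought-idealFor Γ i w)
    ... | yes ⊗ψ =
      ought-mono i
        (λ _ v⊆ r → (λ _ z rz → proj₁ (v⊆ (Eq.trans i r rz))) ∷ proj₂ (v⊆ r))
        (ought-∩ i ⊗ψ (ought-idealFor Γ i w))

    Ideal : Fin n → W → Pred W ℓ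
    Ideal = IdealFor L

    deonticFrame : TDSFrame n ℓ
    deonticFrame = record
      { common = common
      ; R⊗     = λ i w → R□ w ∩ Ideal i w
      ; D8     = λ _ → proj₁
      ; D9     = λ i w →
          let v , wv , v⊆ = ought-satisfiable i (ought-idealFor L i w)
          in  v , wv , λ _ vu → choice⊆moment i wv vu , v⊆ vu
      ; D10    = λ i wv wu (uz , z-ideal) →
          let vu = Eq□.trans (Eq□.sym wv) wu
          in  Eq□.trans vu uz , idealFor-□ (Eq□.sym vu) z-ideal
      -- Ideal worlds fill whole choices, so `v` is its own witness.
      ; D11    = λ i {_} {v} (wv , v-ideal) →
          v , wv , Eq.refl i
            , λ _ vz → choice⊆moment i wv vz , idealFor-choice vz v-ideal
      }

    open TDSSemantics deonticFrame using () renaming (_⊨_ to Satᵈ)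

    infix 4 _⊨ᵈ_
    _⊨ᵈ_ : W → Formula n → Set ℓ
    _⊨ᵈ_ = Satᵈ V

    truth : ∀ φ → ⊗-bodies φ ⊆ˡ L → ∀ w → w ⊨ᵈ φ ⇔ w ⊨ᵘ φ
    truth (var p)    _ w = mk⇔ id id
    truth (~ φ)      s w = mk⇔ (_∘ Equivalence.from IH) (_∘ Equivalence.to IH)
      where IH = truth φ s w
    truth (φ ∧ ψ)    s w = mk⇔ (map (Equivalence.to IHφ) (Equivalence.to IHψ))
                               (map (Equivalence.from IHφ) (Equivalence.from IHψ))
      where
      IHφ = truth φ (s ∘ xs⊆xs++ys _ _) w
      IHψ = truth ψ (s ∘ xs⊆ys++xs _ (⊗-bodies φ)) w
    truth (□ φ)      s w = □-cong R□ (truth φ s) w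
    truth ([ i ] φ)  s w = □-cong R[ i ] (truth φ s) w
    truth ([Ag] φ)   s w = □-cong R[Ag] (truth φ s) w
    truth (𝖦 φ)      s w = □-cong RG (truth φ s) w
    truth (𝖧 φ)      s w = □-cong RH (truth φ s) w
    truth (⊗[ i ] φ) s w = mk⇔
      -- The ideal set is obligatory, and by assumption every choice of the moment inside it forces
      -- `φ`.
      (λ ⊗φ → ought-mono i
        (λ wv v⊆ {u} vu →
          Equivalence.to (IH u) (⊗φ u (choice⊆moment i wv vu , v⊆ vu)))
        (ought-idealFor L i w))
      -- Since `φ` is in `L`, an ideal `u` forces `φ` on its whole choice, hence at itself.
      (λ ⊗φ u (_ , u-ideal) →
        Equivalence.from (IH u)
          (All.lookup u-ideal (s (here refl)) ⊗φ u (Eq.refl i)))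
      where IH = truth φ (s ∘ there)

theorem5 : ∀ {ℓ} → ExcludedMiddle ℓ →
    ∀ {n} (φ : Formula n) → 𝒞ᵈ[ ℓ ]⊨ φ → 𝒞ᵘ[ ℓ ]⊨ φ
theorem5 em φ ⊨φ F V w =
  -- The frame may depend on `φ` and `V`, as validity ranges over the whole class.
  Equivalence.to (truth φ ⊆-refl w) (⊨φ deonticFrame V w)
  where open Ought.Deontic em F V (⊗-bodies φ)
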